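{- Let $G$ be a graph on $n$ vertices with adjacency matrix $M$ (an arbitrary real $n\times n$ matrix), and let $f$ be a perfect $k$-coloring of $G$ with parameter matrix $S$. Then for all $u,v\in V(G)$, $$d([M]^u,[M]^v)\ \ge\ d([S]^{f(u)},[S]^{f(v)}).$$
   Context: A graph $G$ on $n$ vertices, with vertex set $V(G)$, is identified with a real $n\times n$ matrix $M=(m_{u,v})_{u,v\in V(G)}$, called its adjacency matrix (so $G$ is a directed graph whose edges carry real labels $m_{u,v}$; no symmetry or $0/1$ assumption is made). A perfect $k$-coloring of $G$ with parameter matrix $S=(s_{i,j})$ (a real $k\times k$ matrix) is a partition of $V(G)$ into disjoint classes $J_1,\dots,J_k$ such that for all $i,j\in\{1,\dots,k\}$ and all $u\in J_i$ one has $s_{i,j}=\sum_{v\in J_j}m_{u,v}$. It is identified with the map $f:V(G)\to\{1,\dots,k\}$ with $f(v)=i$ if and only if $v\in J_i$. For a square matrix $A$, $[A]^i$ denotes its $i$-th row. For real tuples $x=(x_1,\dots,x_N)$, $y=(y_1,\dots,y_N)$, $d(x,y)=\sum_{i=1}^N|x_i-y_i|$ is the $L_1$ distance. -}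

module Defs where

open import Data.Fin using (Fin; _≟_)
open import Data.List using (List; allFin; filter; foldr; map)
open import Data.List.Membership.Propositional using (_∈_)
open import Data.Nat as ℕ using (ℕ)
import Data.Nat.Properties as ℕ
open import Data.Product using (∃-syntax; _,_)
open import Data.Rational as ℚ using (ℚ; 0ℚ; ½)
import Data.Rational.Properties as ℚ
open import Data.Rational.Solver using (module +-*-Solver)
open import Data.Sum using (inj₁; inj₂)
open import Data.Vec.Functional using (Vector)
open import Relation.Binary.PropositionalEquality

-- The real numbers as Cauchy sequences of rationals, taken up to the
-- setoid equality _≈_ (the difference tends to 0).  Only the additive,
-- order and absolute value structure is defined.

IsCauchy : (ℕ → ℚ) → Set
IsCauchy x = ∀ ε → 0ℚ ℚ.< ε →
  ∃[ N ] (∀ m n → N ℕ.≤ m → N ℕ.≤ n → ℚ.∣ x m ℚ.- x n ∣ ℚ.< ε)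

record ℝ : Set where
  constructor mkℝ
  field
    seq    : ℕ → ℚ
    cauchy : IsCauchy seq

open ℝ public

infix 4 _≈_ _≤_ _≥_

_≈_ : ℝ → ℝ → Set
x ≈ y = ∀ ε → 0ℚ ℚ.< ε →
  ∃[ N ] (∀ n → N ℕ.≤ n → ℚ.∣ seq x n ℚ.- seq y n ∣ ℚ.< ε)

-- The slack ε is what makes _≤_ respect _≈_: a termwise comparison of
-- the representing sequences would not.
_≤_ : ℝ → ℝ → Set
x ≤ y = ∀ ε → 0ℚ ℚ.< ε →
  ∃[ N ] (∀ n → N ℕ.≤ n → seq x n ℚ.< seq y n ℚ.+ ε)

_≥_ : ℝ → ℝ → Set
x ≥ y = y ≤ x

private
  half+half : ∀ ε → ½ ℚ.* ε ℚ.+ ½ ℚ.* ε ≡ ε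
  half+half ε = trans (sym (ℚ.*-distribʳ-+ ε ½ ½)) (ℚ.*-identityˡ ε)

  half>0 : ∀ {ε} → 0ℚ ℚ.< ε → 0ℚ ℚ.< ½ ℚ.* ε
  half>0 {ε} 0<ε =
    subst (ℚ._< ½ ℚ.* ε) (ℚ.*-zeroʳ ½) (ℚ.*-monoʳ-<-pos ½ 0<ε)

  interchange : ∀ a b c d →
    (a ℚ.+ b) ℚ.- (c ℚ.+ d) ≡ (a ℚ.- c) ℚ.+ (b ℚ.- d)
  interchange = solve 4
    (λ a b c d → (a :+ b) :- (c :+ d) := (a :- c) :+ (b :- d)) refl
    where open +-*-Solver

  neg-sub : ∀ a b → (ℚ.- a) ℚ.- (ℚ.- b) ≡ ℚ.- (a ℚ.- b)
  neg-sub = solve 2 (λ a b → (:- a) :- (:- b) := :- (a :- b)) refl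
    where open +-*-Solver

  neg-swap : ∀ a b → ℚ.- (a ℚ.- b) ≡ b ℚ.- a
  neg-swap = solve 2 (λ a b → :- (a :- b) := b :- a) refl
    where open +-*-Solver

  sub-add : ∀ a b → (a ℚ.- b) ℚ.+ b ≡ a
  sub-add = solve 2 (λ a b → (a :- b) :+ b := a) refl
    where open +-*-Solver

  add-sub : ∀ a b → (a ℚ.+ b) ℚ.- b ≡ a
  add-sub = solve 2 (λ a b → (a :+ b) :- b := a) refl
    where open +-*-Solver

  abs-sub : ∀ a b → ℚ.∣ a ∣ ℚ.- ℚ.∣ b ∣ ℚ.≤ ℚ.∣ a ℚ.- b ∣
  abs-sub a b = begin
    ℚ.∣ a ∣ ℚ.- ℚ.∣ b ∣
      ≡⟨ cong (λ c → ℚ.∣ c ∣ ℚ.- ℚ.∣ b ∣) (sub-add a b) ⟨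
    ℚ.∣ (a ℚ.- b) ℚ.+ b ∣ ℚ.- ℚ.∣ b ∣
      ≤⟨ ℚ.+-monoˡ-≤ (ℚ.- ℚ.∣ b ∣) (ℚ.∣p+q∣≤∣p∣+∣q∣ (a ℚ.- b) b) ⟩
    (ℚ.∣ a ℚ.- b ∣ ℚ.+ ℚ.∣ b ∣) ℚ.- ℚ.∣ b ∣
      ≡⟨ add-sub ℚ.∣ a ℚ.- b ∣ ℚ.∣ b ∣ ⟩
    ℚ.∣ a ℚ.- b ∣ ∎
    where open ℚ.≤-Reasoning

  abs-abs-sub : ∀ a b → ℚ.∣ ℚ.∣ a ∣ ℚ.- ℚ.∣ b ∣ ∣ ℚ.≤ ℚ.∣ a ℚ.- b ∣
  abs-abs-sub a b with ℚ.∣p∣≡p∨∣p∣≡-p (ℚ.∣ a ∣ ℚ.- ℚ.∣ b ∣)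
  ... | inj₁ eq = subst (ℚ._≤ ℚ.∣ a ℚ.- b ∣) (sym eq) (abs-sub a b)
  ... | inj₂ eq = begin
    ℚ.∣ ℚ.∣ a ∣ ℚ.- ℚ.∣ b ∣ ∣ ≡⟨ eq ⟩
    ℚ.- (ℚ.∣ a ∣ ℚ.- ℚ.∣ b ∣) ≡⟨ neg-swap ℚ.∣ a ∣ ℚ.∣ b ∣ ⟩
    ℚ.∣ b ∣ ℚ.- ℚ.∣ a ∣       ≤⟨ abs-sub b a ⟩
    ℚ.∣ b ℚ.- a ∣             ≡⟨ cong ℚ.∣_∣ (neg-swap a b) ⟨
    ℚ.∣ ℚ.- (a ℚ.- b) ∣       ≡⟨ ℚ.∣-p∣≡∣p∣ (a ℚ.- b) ⟩
    ℚ.∣ a ℚ.- b ∣             ∎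
    where open ℚ.≤-Reasoning

infix  8 -_
infixl 6 _+_ _-_

0ℝ : ℝ
0ℝ = mkℝ (λ _ → 0ℚ) (λ _ 0<ε → 0 , λ _ _ _ _ → 0<ε)

_+_ : ℝ → ℝ → ℝ
mkℝ x cx + mkℝ y cy = mkℝ (λ n → x n ℚ.+ y n) c
  where
  c : IsCauchy (λ n → x n ℚ.+ y n)
  c ε 0<ε with cx (½ ℚ.* ε) (half>0 0<ε) | cy (½ ℚ.* ε) (half>0 0<ε)
  ... | N₁ , p | N₂ , q = N₁ ℕ.⊔ N₂ , λ m n N≤m N≤n → begin-strict
    ℚ.∣ (x m ℚ.+ y m) ℚ.- (x n ℚ.+ y n) ∣
      ≡⟨ cong ℚ.∣_∣ (interchange (x m) (y m) (x n) (y n)) ⟩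
    ℚ.∣ (x m ℚ.- x n) ℚ.+ (y m ℚ.- y n) ∣
      ≤⟨ ℚ.∣p+q∣≤∣p∣+∣q∣ (x m ℚ.- x n) (y m ℚ.- y n) ⟩
    ℚ.∣ x m ℚ.- x n ∣ ℚ.+ ℚ.∣ y m ℚ.- y n ∣
      <⟨ ℚ.+-mono-<
           (p m n (ℕ.m⊔n≤o⇒m≤o N₁ N₂ N≤m) (ℕ.m⊔n≤o⇒m≤o N₁ N₂ N≤n))
           (q m n (ℕ.m⊔n≤o⇒n≤o N₁ N₂ N≤m) (ℕ.m⊔n≤o⇒n≤o N₁ N₂ N≤n)) ⟩
    ½ ℚ.* ε ℚ.+ ½ ℚ.* ε
      ≡⟨ half+half ε ⟩
    ε ∎
    where open ℚ.≤-Reasoning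

-_ : ℝ → ℝ
- mkℝ x cx = mkℝ (λ n → ℚ.- x n) c
  where
  c : IsCauchy (λ n → ℚ.- x n)
  c ε 0<ε with cx ε 0<ε
  ... | N , p = N , λ m n N≤m N≤n → subst (ℚ._< ε)
    (sym (trans (cong ℚ.∣_∣ (neg-sub (x m) (x n)))
                (ℚ.∣-p∣≡∣p∣ (x m ℚ.- x n))))
    (p m n N≤m N≤n)

_-_ : ℝ → ℝ → ℝ
x - y = x + (- y)

∣_∣ : ℝ → ℝ
∣ mkℝ x cx ∣ = mkℝ (λ n → ℚ.∣ x n ∣) c
  where
  c : IsCauchy (λ n → ℚ.∣ x n ∣)
  c ε 0<ε with cx ε 0<ε
  ... | N , p = N , λ m n N≤m N≤n →
    ℚ.≤-<-trans (abs-abs-sub (x m) (x n)) (p m n N≤m N≤n)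

∑ : {A : Set} → List A → (A → ℝ) → ℝ
∑ xs g = foldr _+_ 0ℝ (map g xs)

d : ∀ {N} → Vector ℝ N → Vector ℝ N → ℝ
d {N} x y = ∑ (allFin N) (λ i → ∣ x i - y i ∣)

-- The row of index i of A is A i.
SquareMatrix : ℕ → Set
SquareMatrix n = Vector (Vector ℝ n) n

-- A graph is identified with its adjacency matrix; its vertex set is Fin n.
Graph : ℕ → Set
Graph = SquareMatrix

Class : ∀ {n k} → (Fin n → Fin k) → Fin k → List (Fin n)
Class {n} f i = filter (λ v → f v ≟ i) (allFin n)

-- The partition is given by the map f; classes are allowed to be empty.
IsPerfectColoring : ∀ {n k} → Graph n → (Fin n → Fin k) → SquareMatrix k → Set
IsPerfectColoring M f S =
  ∀ i j u → u ∈ Class f i → S i j ≈ ∑ (Class f j) (λ v → M u v)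

{-# OPTIONS --safe #-}
-- Every row sum of S over the classes is a regrouped row sum of M, so the
-- triangle inequality inside each class gives the bound.  Only replacing S by
-- these sums needs the ε-order; all other steps hold termwise for the
-- representing sequences.

module Submission where

open import Data.Nat using (ℕ)
open import Data.Fin using (Fin; _≟_)
open import Defs
open import Data.List using (List; []; _∷_; allFin; filter)
open import Data.List.Membership.Propositional using (_∈_)
open import Data.List.Membership.Propositional.Properties using (∈-allFin; ∈-filter⁺)
open import Data.List.Properties using (filter-accept; filter-reject)
open import Data.List.Relation.Unary.All as All using (All; []; _∷_)
open import Data.List.Relation.Unary.Any using (here; there)
open import Data.List.Relation.Unary.Unique.Propositional using (Unique; []; _∷_)
open import Data.List.Relation.Unary.Unique.Propositional.Properties using (allFin⁺)
import Data.Nat as ℕ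
import Data.Nat.Properties as ℕ
open import Data.Product using (_,_)
open import Data.Rational as ℚ using (ℚ; 0ℚ; ½)
import Data.Rational.Properties as ℚ
open import Data.Rational.Solver using (module +-*-Solver)
open import Function using (_∘_)
open import Relation.Binary.PropositionalEquality
open +-*-Solver using (solve; _:+_; _:-_; :-_; _:=_)

infix 4 _≤ₛ_

-- This relation does not respect `_≈_`. Sums and absolute values are computed term by term, so two
-- expressions in the same entries can be compared by rational inequalities at a fixed index,
-- without any slack.
_≤ₛ_ : ℝ → ℝ → Set
x ≤ₛ y = ∀ n → seq x n ℚ.≤ seq y n

half+half : ∀ ε → ½ ℚ.* ε ℚ.+ ½ ℚ.* ε ≡ ε
half+half ε = trans (sym (ℚ.*-distribʳ-+ ε ½ ½)) (ℚ.*-identityˡ ε)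

half>0 : ∀ {ε} → 0ℚ ℚ.< ε → 0ℚ ℚ.< ½ ℚ.* ε
half>0 {ε} 0<ε = subst (ℚ._< ½ ℚ.* ε) (ℚ.*-zeroʳ ½) (ℚ.*-monoʳ-<-pos ½ 0<ε)

p<p+ε : ∀ p {ε} → 0ℚ ℚ.< ε → p ℚ.< p ℚ.+ ε
p<p+ε p {ε} 0<ε = subst (ℚ._< p ℚ.+ ε) (ℚ.+-identityʳ p) (ℚ.+-monoʳ-< p 0<ε)

-- A termwise bound survives adding the same ε to both sides, so the threshold `N` from the first
-- inequality still works.
≤-≤ₛ-trans : ∀ {x y z} → x ≤ y → y ≤ₛ z → x ≤ z
≤-≤ₛ-trans x≤y y≤z ε 0<ε with x≤y ε 0<ε
... | N , p = N , λ n N≤n → ℚ.<-≤-trans (p n N≤n) (ℚ.+-monoˡ-≤ ε (y≤z n))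

+-mono-≤ : ∀ {x y x′ y′} → x ≤ x′ → y ≤ y′ → x + y ≤ x′ + y′
+-mono-≤ {x} {y} {x′} {y′} x≤x′ y≤y′ ε 0<ε
  with x≤x′ (½ ℚ.* ε) (half>0 0<ε) | y≤y′ (½ ℚ.* ε) (half>0 0<ε)
... | N₁ , p | N₂ , q = N₁ ℕ.⊔ N₂ , λ n N≤n → begin-strict
  seq x n ℚ.+ seq y n
    <⟨ ℚ.+-mono-< (p n (ℕ.m⊔n≤o⇒m≤o N₁ N₂ N≤n)) (q n (ℕ.m⊔n≤o⇒n≤o N₁ N₂ N≤n)) ⟩
  (seq x′ n ℚ.+ ½ ℚ.* ε) ℚ.+ (seq y′ n ℚ.+ ½ ℚ.* ε)
    ≡⟨ interchange (seq x′ n) (½ ℚ.* ε) (seq y′ n) (½ ℚ.* ε) ⟩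
  (seq x′ n ℚ.+ seq y′ n) ℚ.+ (½ ℚ.* ε ℚ.+ ½ ℚ.* ε)
    ≡⟨ cong (seq x′ n ℚ.+ seq y′ n ℚ.+_) (half+half ε) ⟩
  (seq x′ n ℚ.+ seq y′ n) ℚ.+ ε ∎
  where
  open ℚ.≤-Reasoning
  interchange : ∀ a b c e → (a ℚ.+ b) ℚ.+ (c ℚ.+ e) ≡ (a ℚ.+ c) ℚ.+ (b ℚ.+ e)
  interchange = solve 4 (λ a b c e → (a :+ b) :+ (c :+ e) := (a :+ c) :+ (b :+ e)) refl

-- Replacing each argument costs at most half of ε once both approximations have become that good.
-- This is where the equations for the entries of `S`, known only up to `_≈_`, enter.
∣-∣-resp-≈ : ∀ {x y x′ y′} → x ≈ x′ → y ≈ y′ → ∣ x - y ∣ ≤ ∣ x′ - y′ ∣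
∣-∣-resp-≈ {x} {y} {x′} {y′} x≈x′ y≈y′ ε 0<ε
  with x≈x′ (½ ℚ.* ε) (half>0 0<ε) | y≈y′ (½ ℚ.* ε) (half>0 0<ε)
... | N₁ , p | N₂ , q = N₁ ℕ.⊔ N₂ , λ n N≤n → begin-strict
  ℚ.∣ seq x n ℚ.- seq y n ∣
    ≤⟨ perturb (seq x n) (seq y n) (seq x′ n) (seq y′ n) ⟩
  ℚ.∣ seq x′ n ℚ.- seq y′ n ∣
    ℚ.+ (ℚ.∣ seq x n ℚ.- seq x′ n ∣ ℚ.+ ℚ.∣ seq y n ℚ.- seq y′ n ∣)
    <⟨ ℚ.+-monoʳ-< ℚ.∣ seq x′ n ℚ.- seq y′ n ∣
         (ℚ.+-mono-< (p n (ℕ.m⊔n≤o⇒m≤o N₁ N₂ N≤n)) (q n (ℕ.m⊔n≤o⇒n≤o N₁ N₂ N≤n))) ⟩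
  ℚ.∣ seq x′ n ℚ.- seq y′ n ∣ ℚ.+ (½ ℚ.* ε ℚ.+ ½ ℚ.* ε)
    ≡⟨ cong (ℚ.∣ seq x′ n ℚ.- seq y′ n ∣ ℚ.+_) (half+half ε) ⟩
  ℚ.∣ seq x′ n ℚ.- seq y′ n ∣ ℚ.+ ε ∎
  where
  open ℚ.≤-Reasoning
  -- The path from `a` to `b` is routed through `a′` and `b′`.
  split : ∀ a b a′ b′ →
    a ℚ.- b ≡ (a′ ℚ.- b′) ℚ.+ ((a ℚ.- a′) ℚ.+ (ℚ.- (b ℚ.- b′)))
  split = solve 4
    (λ a b a′ b′ → a :- b := (a′ :- b′) :+ ((a :- a′) :+ (:- (b :- b′)))) refl
  perturb : ∀ a b a′ b′ → ℚ.∣ a ℚ.- b ∣ ℚ.≤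
    ℚ.∣ a′ ℚ.- b′ ∣ ℚ.+ (ℚ.∣ a ℚ.- a′ ∣ ℚ.+ ℚ.∣ b ℚ.- b′ ∣)
  perturb a b a′ b′ = begin
    ℚ.∣ a ℚ.- b ∣
      ≡⟨ cong ℚ.∣_∣ (split a b a′ b′) ⟩
    ℚ.∣ (a′ ℚ.- b′) ℚ.+ ((a ℚ.- a′) ℚ.+ (ℚ.- (b ℚ.- b′))) ∣
      ≤⟨ ℚ.∣p+q∣≤∣p∣+∣q∣ (a′ ℚ.- b′) _ ⟩
    ℚ.∣ a′ ℚ.- b′ ∣ ℚ.+ ℚ.∣ (a ℚ.- a′) ℚ.+ (ℚ.- (b ℚ.- b′)) ∣
      ≤⟨ ℚ.+-monoʳ-≤ ℚ.∣ a′ ℚ.- b′ ∣ (ℚ.∣p+q∣≤∣p∣+∣q∣ (a ℚ.- a′) _) ⟩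
    ℚ.∣ a′ ℚ.- b′ ∣ ℚ.+ (ℚ.∣ a ℚ.- a′ ∣ ℚ.+ ℚ.∣ ℚ.- (b ℚ.- b′) ∣)
      ≡⟨ cong (λ c → ℚ.∣ a′ ℚ.- b′ ∣ ℚ.+ (ℚ.∣ a ℚ.- a′ ∣ ℚ.+ c)) (ℚ.∣-p∣≡∣p∣ (b ℚ.- b′)) ⟩
    ℚ.∣ a′ ℚ.- b′ ∣ ℚ.+ (ℚ.∣ a ℚ.- a′ ∣ ℚ.+ ℚ.∣ b ℚ.- b′ ∣) ∎

∑-mono-≤ : ∀ {A : Set} (xs : List A) {g h : A → ℝ} →
  (∀ x → g x ≤ h x) → ∑ xs g ≤ ∑ xs h
∑-mono-≤ []       g≤h ε 0<ε = 0 , λ _ _ → p<p+ε 0ℚ 0<ε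
∑-mono-≤ (x ∷ xs) {g} {h} g≤h =
  +-mono-≤ {g x} {∑ xs g} {h x} {∑ xs h} (g≤h x) (∑-mono-≤ xs g≤h)

∑-mono-≤ₛ : ∀ {A : Set} (xs : List A) {g h : A → ℝ} →
  (∀ x → g x ≤ₛ h x) → ∑ xs g ≤ₛ ∑ xs h
∑-mono-≤ₛ []       g≤h n = ℚ.≤-refl
∑-mono-≤ₛ (x ∷ xs) g≤h n = ℚ.+-mono-≤ (g≤h x n) (∑-mono-≤ₛ xs g≤h n)

∣∑-∑∣≤∑∣-∣ : ∀ {A : Set} (xs : List A) (g h : A → ℝ) →
  ∣ ∑ xs g - ∑ xs h ∣ ≤ₛ ∑ xs (λ x → ∣ g x - h x ∣)
∣∑-∑∣≤∑∣-∣ []       g h n = ℚ.≤-refl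
∣∑-∑∣≤∑∣-∣ (x ∷ xs) g h n = begin
  ℚ.∣ (a ℚ.+ b) ℚ.- (a′ ℚ.+ b′) ∣
    ≡⟨ cong ℚ.∣_∣ (interchange a b a′ b′) ⟩
  ℚ.∣ (a ℚ.- a′) ℚ.+ (b ℚ.- b′) ∣
    ≤⟨ ℚ.∣p+q∣≤∣p∣+∣q∣ (a ℚ.- a′) (b ℚ.- b′) ⟩
  ℚ.∣ a ℚ.- a′ ∣ ℚ.+ ℚ.∣ b ℚ.- b′ ∣
    ≤⟨ ℚ.+-monoʳ-≤ ℚ.∣ a ℚ.- a′ ∣ (∣∑-∑∣≤∑∣-∣ xs g h n) ⟩
  ℚ.∣ a ℚ.- a′ ∣ ℚ.+ seq (∑ xs (λ y → ∣ g y - h y ∣)) n ∎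
  where
  open ℚ.≤-Reasoning
  a b a′ b′ : ℚ
  a  = seq (g x) n
  b  = seq (∑ xs g) n
  a′ = seq (h x) n
  b′ = seq (∑ xs h) n
  interchange : ∀ a b c e → (a ℚ.+ b) ℚ.- (c ℚ.+ e) ≡ (a ℚ.- c) ℚ.+ (b ℚ.- e)
  interchange = solve 4 (λ a b c e → (a :+ b) :- (c :+ e) := (a :- c) :+ (b :- e)) refl

-- Equality is taken between `n`-th terms because propositional equality of reals would also compare
-- their Cauchy proofs.
∑-cong : ∀ {A : Set} (g h : A → ℝ) n {xs : List A} →
  All (λ x → seq (g x) n ≡ seq (h x) n) xs → seq (∑ xs g) n ≡ seq (∑ xs h) n
∑-cong g h n []         = refl
∑-cong g h n (eq ∷ eqs) = cong₂ ℚ._+_ eq (∑-cong g h n eqs)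

-- Uniqueness makes `i` occur exactly once, so the increment `a` is counted once. This serves the
-- induction step of `∑-fibres`.
∑-update : ∀ {A : Set} (g h : A → ℝ) n (a : ℚ) {xs : List A} {i : A} →
  Unique xs → i ∈ xs → seq (g i) n ≡ a ℚ.+ seq (h i) n →
  (∀ {x} → i ≢ x → seq (g x) n ≡ seq (h x) n) →
  seq (∑ xs g) n ≡ a ℚ.+ seq (∑ xs h) n
∑-update g h n a {i ∷ xs} (i∉xs ∷ _) (here refl) gi≡ g≡h = begin
  seq (g i) n ℚ.+ seq (∑ xs g) n         ≡⟨ cong₂ ℚ._+_ gi≡ (∑-cong g h n (All.map g≡h i∉xs)) ⟩
  (a ℚ.+ seq (h i) n) ℚ.+ seq (∑ xs h) n ≡⟨ ℚ.+-assoc a (seq (h i) n) (seq (∑ xs h) n) ⟩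
  a ℚ.+ (seq (h i) n ℚ.+ seq (∑ xs h) n) ∎
  where open ≡-Reasoning
∑-update g h n a {x ∷ xs} (x∉xs ∷ xs!) (there i∈xs) gi≡ g≡h = begin
  seq (g x) n ℚ.+ seq (∑ xs g) n         ≡⟨ cong₂ ℚ._+_ gx≡hx (∑-update g h n a xs! i∈xs gi≡ g≡h) ⟩
  seq (h x) n ℚ.+ (a ℚ.+ seq (∑ xs h) n) ≡⟨ swap (seq (h x) n) a (seq (∑ xs h) n) ⟩
  a ℚ.+ (seq (h x) n ℚ.+ seq (∑ xs h) n) ∎
  where
  open ≡-Reasoning
  gx≡hx : seq (g x) n ≡ seq (h x) n
  -- The head differs from `i`, since `i` lies in the tail and the head does not.
  gx≡hx = g≡h (All.lookup x∉xs i∈xs ∘ sym)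
  swap : ∀ p q r → p ℚ.+ (q ℚ.+ r) ≡ q ℚ.+ (p ℚ.+ r)
  swap = solve 3 (λ p q r → p :+ (q :+ r) := q :+ (p :+ r)) refl

∑-zero : ∀ {A : Set} (xs : List A) n → seq (∑ xs (λ _ → 0ℝ)) n ≡ 0ℚ
∑-zero []       n = refl
∑-zero (_ ∷ xs) n = trans (ℚ.+-identityˡ _) (∑-zero xs n)

-- Induction on the list: a new element `x` joins the fibre over `f x` and leaves all others
-- unchanged. For the empty list every fibre is empty, so the outer sum is a sum of zeros.
∑-fibres : ∀ {A : Set} {k} (f : A → Fin k) (xs : List A) (g : A → ℝ) n →
  seq (∑ (allFin k) (λ j → ∑ (filter (λ x → f x ≟ j) xs) g)) n ≡ seq (∑ xs g) n
∑-fibres {k = k} f []       g n = ∑-zero (allFin k) n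
∑-fibres {A} {k} f (x ∷ xs) g n = begin
  seq (∑ (allFin k) (fibre (x ∷ xs))) n
    ≡⟨ ∑-update (fibre (x ∷ xs)) (fibre xs) n (seq (g x) n)
         (allFin⁺ k) (∈-allFin (f x)) accept reject ⟩
  seq (g x) n ℚ.+ seq (∑ (allFin k) (fibre xs)) n
    ≡⟨ cong (seq (g x) n ℚ.+_) (∑-fibres f xs g n) ⟩
  seq (g x) n ℚ.+ seq (∑ xs g) n ∎
  where
  open ≡-Reasoning
  fibre : List A → Fin k → ℝ
  fibre ys j = ∑ (filter (λ y → f y ≟ j) ys) g
  accept : seq (fibre (x ∷ xs) (f x)) n ≡ seq (g x) n ℚ.+ seq (fibre xs (f x)) n
  accept = cong (λ ys → seq (∑ ys g) n) (filter-accept (λ y → f y ≟ f x) refl)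
  reject : ∀ {j} → f x ≢ j → seq (fibre (x ∷ xs) j) n ≡ seq (fibre xs j) n
  reject {j} fx≢j = cong (λ ys → seq (∑ ys g) n) (filter-reject (λ y → f y ≟ j) fx≢j)

theorem1 : ∀ {n k : ℕ} (M : Graph n) (f : Fin n → Fin k) (S : SquareMatrix k) →
    IsPerfectColoring M f S →
    ∀ (u v : Fin n) → d (M u) (M v) ≥ d (S (f u)) (S (f v))
theorem1 {n} {k} M f S perfect u v =
  ≤-≤ₛ-trans
    {d (S (f u)) (S (f v))}
    {∑ (allFin k) (λ j → ∣ ∑ (Class f j) (M u) - ∑ (Class f j) (M v) ∣)}
    {d (M u) (M v)}
    -- Perfectness at `u` and `v` turns the two entries in column `j` into sums of `M u` and `M v`
    -- over class `j`.
    (∑-mono-≤ (allFin k) λ j →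
      ∣-∣-resp-≈ {S (f u) j} {S (f v) j} {∑ (Class f j) (M u)} {∑ (Class f j) (M v)}
        (perfect (f u) j u (∈-own-class u)) (perfect (f v) j v (∈-own-class v)))
    λ m → ℚ.≤-trans
      -- The triangle inequality is applied class by class; the classes are the fibres of `f`, so
      -- the double sum then collapses to one over all vertices.
      (∑-mono-≤ₛ (allFin k) (λ j → ∣∑-∑∣≤∑∣-∣ (Class f j) (M u) (M v)) m)
      (ℚ.≤-reflexive (∑-fibres f (allFin n) (λ w → ∣ M u w - M v w ∣) m))
  where
  ∈-own-class : ∀ w → w ∈ Class f (f w)
  ∈-own-class w = ∈-filter⁺ (λ y → f y ≟ f w) (∈-allFin w) refl
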